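{- Let $r\ge 6$ and $n\ge 2(r-2)(r-1)+1$ be integers, and let $\mathcal{H}=\mathcal{H}(2n,r)$. Then, for positive integers $k$: (1) $\mathcal{H}$ is not $k$-NMNR colourable for $k>n$; (2) $\mathcal{H}$ is $k$-NMNR colourable for $\lceil n/(r-2)\rceil\le k\le n$; (3) $\mathcal{H}$ is not $k$-NMNR colourable for $2r-5\le k<\lceil n/(r-2)\rceil$; (4) $\mathcal{H}$ is $k$-NMNR colourable for $2\le k\le 2r-6$.
   Context: $\mathcal{H}(2n,r)$ is the $r$-uniform hypergraph with $2n$ vertices partitioned into $n$ classes of size $2$, whose edges are all the $r$-subsets of vertices that contain both vertices of exactly one class and whose other $r-2$ vertices come from $r-2$ distinct further classes (one vertex from each). (Equivalently, edges are the $r$-subsets $R$ whose non-zero intersection sizes with the classes form the partition $(1^{r-2},2)$ of $r$.) A $k$-NMNR (non-monochromatic non-rainbow) colouring of a hypergraph is a colouring of its vertices using exactly $k$ distinct colours (all $k$ are used) such that no edge has all its vertices of the same colour and no edge has all its vertices of pairwise distinct colours. A hypergraph is $k$-NMNR colourable if it has a $k$-NMNR colouring. -}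

module Defs where

open import Data.Fin.Base using (Fin; zero; suc; combine)
open import Data.Fin.Subset using (Subset; _∈_; _∩_; _∪_; ⁅_⁆; ∣_∣)
open import Data.Nat.Base using (ℕ; _+_; _*_; _∸_; _≤_; NonZero; >-nonZero)
open import Data.Nat.DivMod using (_/_)
open import Data.Nat.Properties using (m<n⇒0<n∸m; ≤-trans; m≤m+n)
open import Data.Product.Base using (_×_; Σ-syntax)
open import Function.Definitions using (Surjective)
open import Relation.Binary.PropositionalEquality.Core using (_≡_; _≢_)
open import Relation.Nullary.Negation.Core using (¬_)

record Hypergraph : Set₁ where
  field
    order : ℕ
    Edge  : Subset order → Set

open Hypergraph public

-- Fin (2 * n) is Fin 2 × Fin n via combine; the class is the second component.
class : ∀ {n} → Fin n → Subset (2 * n)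
class i = ⁅ combine {2} zero i ⁆ ∪ ⁅ combine {2} (suc zero) i ⁆

-- As the classes partition the vertices, an r-subset that contains class i
-- and meets every other class at most once has its remaining r - 2 vertices
-- in r - 2 distinct further classes.
-- The first parameter is the number n of classes, not the number of vertices.
ℋ : ℕ → ℕ → Hypergraph
ℋ n r = record
  { order = 2 * n
  ; Edge  = λ e → ∣ e ∣ ≡ r
                × (Σ[ i ∈ Fin n ] (∣ e ∩ class i ∣ ≡ 2
                  × (∀ (j : Fin n) → j ≢ i → ∣ e ∩ class j ∣ ≤ 1)))
  }

module _ {v k : ℕ} (c : Fin v → Fin k) (e : Subset v) where

  Monochromatic : Set
  Monochromatic = ∀ {x y} → x ∈ e → y ∈ e → c x ≡ c y

  Rainbow : Set
  Rainbow = ∀ {x y} → x ∈ e → y ∈ e → c x ≡ c y → x ≡ y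

-- Surjectivity says that all k colours are used.
record NMNRColouring (H : Hypergraph) (k : ℕ) : Set where
  field
    colour           : Fin (order H) → Fin k
    surjective       : Surjective _≡_ _≡_ colour
    nonMonochromatic : ∀ e → Edge H e → ¬ Monochromatic colour e
    nonRainbow       : ∀ e → Edge H e → ¬ Rainbow colour e

NMNRColourable : Hypergraph → ℕ → Set
NMNRColourable = NMNRColouring

⌈_/_⌉ : (m d : ℕ) .{{_ : NonZero d}} → ℕ
⌈ m / d ⌉ = (m + (d ∸ 1)) / d

r∸2-nonZero : ∀ {r} → 6 ≤ r → NonZero (r ∸ 2)
r∸2-nonZero 6≤r = >-nonZero (m<n⇒0<n∸m (≤-trans (m≤m+n 3 3) 6≤r))

{-# OPTIONS --safe #-}
module Submission where

-- Write r = 2 + s, so that an edge meets s + 1 classes, one of them in two vertices. Monochromatic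
-- classes with at most s of each colour give (2). For (4), almost all classes get the colours {0, 1},
-- and the other colours go in pairs to at most s - 2 classes; a rainbow edge would meet at most s classes.
-- For (1) and (3), fix a section t of the colouring c. If t uses both vertices of some class and meets
-- s + 1 classes, its image contains a rainbow edge. In both cases t can be chosen to use both vertices
-- of a class: by the pigeonhole principle in (1), and in (3) because otherwise all classes are
-- monochromatic and some colour fills s + 1 of them. As k ≥ 2s - 1, t meets at least s classes.
-- Suppose it meets exactly s. Then at most one colour is alone in its class under t. If a vertex in an
-- unmet class has a colour that shares its class under t, moving t to that vertex makes it meet s + 1
-- classes, and since s + 1 < k it still uses some class twice. So all vertices of the unmet classes
-- have the same colour, which gives a monochromatic edge.

open import Defs
open import Data.Empty using (⊥)
open import Data.Fin.Base using (Fin; zero; suc; toℕ; fromℕ<; inject≤; combine; remQuot; opposite)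
open import Data.Fin.Properties
  using (_≟_; any?; pigeonhole; <⇒≢; injective⇒≤; suc-injective; toℕ-injective; toℕ<n; toℕ-fromℕ<;
         toℕ-inject≤; inject≤-injective; combine-injective; remQuot-combine; combine-remQuot)
open import Data.Fin.Subset using (Subset; inside; outside; ⁅_⁆; _∪_; _∩_; ∣_∣)
  renaming (⊥ to ∅; _∈_ to _∈ₛ_; _∉_ to _∉ₛ_)
open import Data.Fin.Subset.Properties
  using (∉⊥; ∣⊥∣≡0; ∣⁅x⁆∣≡1; ∪-identityˡ; x∈⁅x⁆; x∈⁅y⁆⇒x≡y; x∈p∪q⁻; x∈p∪q⁺; x∈p∩q⁺; x∈p∩q⁻;
         p∩q⊆q; p⊆q⇒∣p∣≤∣q∣; ⊆-antisym; _∈?_)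
open import Data.List.Base using (List; []; _∷_; _++_; length; lookup; map; filter; take; allFin)
open import Data.List.Properties
  using (length-map; length-++; length-take; length-tabulate; map-∘; map-cong; map-id; take++drop≡id)
open import Data.List.Membership.Propositional using (_∈_)
open import Data.List.Membership.Propositional.Properties
  using (∈-lookup; ∈-map⁺; ∈-map⁻; ∈-filter⁺; ∈-filter⁻; ∈-++⁺ˡ; ∈-++⁺ʳ; ∈-allFin)
open import Data.List.Membership.Setoid.Properties using (index-injective)
open import Data.List.Relation.Binary.Subset.Propositional using (_⊆_)
open import Data.List.Relation.Unary.All as All using (All; []; _∷_)
import Data.List.Relation.Unary.All.Properties as All
open import Data.List.Relation.Unary.AllPairs using ([]; _∷_)
open import Data.List.Relation.Unary.Any as Any using (here; there)
open import Data.List.Relation.Unary.Unique.Propositional using (Unique)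
import Data.List.Relation.Unary.Unique.Propositional.Properties as Unique
open import Data.Nat.Base using (ℕ; zero; suc; _+_; _*_; _∸_; _⊓_; _≤_; _<_; z≤n; s≤s; NonZero; >-nonZero)
open import Data.Nat.DivMod
  using (_/_; _%_; _mod_; m%n<n; m<n⇒m%n≡m; m≡m%n+[m/n]*n; m<n*o⇒m/o<n; m*n/n≡m; m/n*n≤m; /-monoˡ-≤)
import Data.Nat.Properties as ℕ
open import Data.Product.Base using (_×_; _,_; proj₁; proj₂; ∃)
open import Data.Sum.Base using (_⊎_; inj₁; inj₂)
open import Data.Vec.Base using ([]; _∷_; here; there)
open import Function.Base using (_∘_)
open import Relation.Binary.PropositionalEquality
open import Relation.Nullary.Decidable using (Dec; yes; no; ¬?; _×-dec_; decidable-stable)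
open import Relation.Nullary.Negation.Core using (¬_; contradiction)

-- Lists without repetition

module _ {a} {A : Set a} where

  lookup-injective : ∀ {xs : List A} → Unique xs → ∀ {i j} → lookup xs i ≡ lookup xs j → i ≡ j
  lookup-injective (_ ∷ _)  {zero}  {zero}  _  = refl
  lookup-injective (≢s ∷ _) {zero}  {suc j} eq = contradiction eq (All.lookup ≢s (∈-lookup j))
  lookup-injective (≢s ∷ _) {suc i} {zero}  eq = contradiction (sym eq) (All.lookup ≢s (∈-lookup i))
  lookup-injective (_ ∷ u)  {suc i} {suc j} eq = cong suc (lookup-injective u eq)

  unique⇒length≤ : ∀ {xs : List A} {m} → Unique xs → (f : A → Fin m) →
                   (∀ {x y} → x ∈ xs → y ∈ xs → f x ≡ f y → x ≡ y) → length xs ≤ m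
  unique⇒length≤ {xs} u f inj =
    injective⇒≤ {f = f ∘ lookup xs} (lookup-injective u ∘ inj (∈-lookup _) (∈-lookup _))

  unique-⊆⇒length≤ : ∀ {xs ys : List A} → Unique xs → xs ⊆ ys → length xs ≤ length ys
  unique-⊆⇒length≤ u xs⊆ys =
    injective⇒≤ {f = Any.index ∘ xs⊆ys ∘ ∈-lookup}
      (lookup-injective u ∘ index-injective (setoid A) (xs⊆ys (∈-lookup _)) (xs⊆ys (∈-lookup _)))

-- Cardinalities of subsets

elements : ∀ {v} → Subset v → List (Fin v)
elements []            = []
elements (inside ∷ p)  = zero ∷ map suc (elements p)
elements (outside ∷ p) = map suc (elements p)

length-elements : ∀ {v} (p : Subset v) → length (elements p) ≡ ∣ p ∣
length-elements []            = refl
length-elements (inside ∷ p)  = cong suc (trans (length-map suc (elements p)) (length-elements p))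
length-elements (outside ∷ p) = trans (length-map suc (elements p)) (length-elements p)

∈-elements⁻ : ∀ {v} (p : Subset v) {x} → x ∈ elements p → x ∈ₛ p
∈-elements⁻ (inside ∷ p)  (here refl) = here
∈-elements⁻ (inside ∷ p)  (there x∈)  with _ , y∈ , refl ← ∈-map⁻ suc x∈ = there (∈-elements⁻ p y∈)
∈-elements⁻ (outside ∷ p) x∈          with _ , y∈ , refl ← ∈-map⁻ suc x∈ = there (∈-elements⁻ p y∈)

elements-unique : ∀ {v} (p : Subset v) → Unique (elements p)
elements-unique []            = []
elements-unique (inside ∷ p)  =
  All.tabulate (λ x∈ 0≡x → contradiction (trans 0≡x (proj₂ (proj₂ (∈-map⁻ suc x∈)))) λ ())
  ∷ Unique.map⁺ (λ { refl → refl }) (elements-unique p)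
elements-unique (outside ∷ p) = Unique.map⁺ (λ { refl → refl }) (elements-unique p)

-- With `m = 1` and a constant map, this turns "any two elements are equal" into the bound 1 on the
-- cardinality.
injectiveOn⇒∣p∣≤ : ∀ {v m} (p : Subset v) (f : Fin v → Fin m) →
                   (∀ {x y} → x ∈ₛ p → y ∈ₛ p → f x ≡ f y → x ≡ y) → ∣ p ∣ ≤ m
injectiveOn⇒∣p∣≤ p f inj = subst (_≤ _) (length-elements p)
  (unique⇒length≤ (elements-unique p) f λ x∈ y∈ → inj (∈-elements⁻ p x∈) (∈-elements⁻ p y∈))

∣⁅x⁆∪p∣≡1+∣p∣ : ∀ {v} (x : Fin v) (p : Subset v) → x ∉ₛ p → ∣ ⁅ x ⁆ ∪ p ∣ ≡ suc ∣ p ∣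
∣⁅x⁆∪p∣≡1+∣p∣ zero    (inside ∷ p)  x∉p = contradiction here x∉p
∣⁅x⁆∪p∣≡1+∣p∣ zero    (outside ∷ p) x∉p = cong (suc ∘ ∣_∣) (∪-identityˡ p)
∣⁅x⁆∪p∣≡1+∣p∣ (suc x) (inside ∷ p)  x∉p = cong suc (∣⁅x⁆∪p∣≡1+∣p∣ x p (x∉p ∘ there))
∣⁅x⁆∪p∣≡1+∣p∣ (suc x) (outside ∷ p) x∉p = ∣⁅x⁆∪p∣≡1+∣p∣ x p (x∉p ∘ there)

∣⁅x⁆∪⁅y⁆∣≡2 : ∀ {v} {x y : Fin v} → x ≢ y → ∣ ⁅ x ⁆ ∪ ⁅ y ⁆ ∣ ≡ 2
∣⁅x⁆∪⁅y⁆∣≡2 {x = x} {y} x≢y =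
  trans (∣⁅x⁆∪p∣≡1+∣p∣ x ⁅ y ⁆ (x≢y ∘ x∈⁅y⁆⇒x≡y y))
        (cong suc (∣⁅x⁆∣≡1 y))

∣p∣≤1⇒≡ : ∀ {v} {p : Subset v} {x y} → ∣ p ∣ ≤ 1 → x ∈ₛ p → y ∈ₛ p → x ≡ y
∣p∣≤1⇒≡ {p = p} {x} {y} ∣p∣≤1 x∈p y∈p with x ≟ y
... | yes x≡y = x≡y
... | no  x≢y = contradiction
  (ℕ.≤-trans (ℕ.≤-reflexive (sym (∣⁅x⁆∪⁅y⁆∣≡2 x≢y))) (ℕ.≤-trans (p⊆q⇒∣p∣≤∣q∣ ⊆p) ∣p∣≤1))
  λ { (s≤s ()) }
  where
  ⊆p : ∀ {z} → z ∈ₛ ⁅ x ⁆ ∪ ⁅ y ⁆ → z ∈ₛ p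
  ⊆p z∈ with x∈p∪q⁻ ⁅ x ⁆ ⁅ y ⁆ z∈
  ... | inj₁ z∈x rewrite x∈⁅y⁆⇒x≡y x z∈x = x∈p
  ... | inj₂ z∈y rewrite x∈⁅y⁆⇒x≡y y z∈y = y∈p

fromList : ∀ {v} → List (Fin v) → Subset v
fromList []       = ∅
fromList (x ∷ xs) = ⁅ x ⁆ ∪ fromList xs

∈-fromList⁺ : ∀ {v} {x : Fin v} {xs} → x ∈ xs → x ∈ₛ fromList xs
∈-fromList⁺ (here refl) = x∈p∪q⁺ (inj₁ (x∈⁅x⁆ _))
∈-fromList⁺ (there x∈)  = x∈p∪q⁺ (inj₂ (∈-fromList⁺ x∈))

∈-fromList⁻ : ∀ {v} {x : Fin v} xs → x ∈ₛ fromList xs → x ∈ xs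
∈-fromList⁻ []       x∈ = contradiction x∈ ∉⊥
∈-fromList⁻ (y ∷ ys) x∈ with x∈p∪q⁻ ⁅ y ⁆ (fromList ys) x∈
... | inj₁ x∈y = here (x∈⁅y⁆⇒x≡y y x∈y)
... | inj₂ x∈p = there (∈-fromList⁻ ys x∈p)

∣fromList∣ : ∀ {v} {xs : List (Fin v)} → Unique xs → ∣ fromList xs ∣ ≡ length xs
∣fromList∣ {v} []                  = ∣⊥∣≡0 v
∣fromList∣ {xs = x ∷ xs} u@(_ ∷ u′) =
  trans (∣⁅x⁆∪p∣≡1+∣p∣ x (fromList xs) (Unique.Unique[x∷xs]⇒x∉xs u ∘ ∈-fromList⁻ xs))
        (cong suc (∣fromList∣ u′))

-- Vertices and classes

module Classes (n : ℕ) where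

  vertex : Fin 2 → Fin n → Fin (2 * n)
  vertex = combine

  bit : Fin (2 * n) → Fin 2
  bit = proj₁ ∘ remQuot {2} n

  cls : Fin (2 * n) → Fin n
  cls = proj₂ ∘ remQuot {2} n

  bit-vertex : ∀ b i → bit (vertex b i) ≡ b
  bit-vertex b i = cong proj₁ (remQuot-combine b i)

  cls-vertex : ∀ b i → cls (vertex b i) ≡ i
  cls-vertex b i = cong proj₂ (remQuot-combine b i)

  vertex-bit-cls : ∀ x → vertex (bit x) (cls x) ≡ x
  vertex-bit-cls = combine-remQuot {2} n

  bit-cls-injective : ∀ {x y} → bit x ≡ bit y → cls x ≡ cls y → x ≡ y
  bit-cls-injective {x} {y} b≡ c≡ =
    trans (sym (vertex-bit-cls x)) (trans (cong₂ vertex b≡ c≡) (vertex-bit-cls y))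

  vertex₀≢vertex₁ : ∀ i → vertex zero i ≢ vertex (suc zero) i
  vertex₀≢vertex₁ i eq =
    contradiction (trans (sym (bit-vertex zero i)) (trans (cong bit eq) (bit-vertex (suc zero) i))) λ ()

  other : ∀ x → ∃ λ y → y ≢ x × cls y ≡ cls x
  other x = vertex (opposite (bit x)) (cls x) ,
    (λ y≡x → opposite≢ (bit x) (trans (sym (bit-vertex _ (cls x))) (cong bit y≡x))) ,
    cls-vertex (opposite (bit x)) (cls x)
    where
    opposite≢ : ∀ (b : Fin 2) → opposite b ≢ b
    opposite≢ zero       ()
    opposite≢ (suc zero) ()

  -- Within a class a vertex is determined by its bit, and the distinct bits of `x` and `y` exhaust
  -- `Fin 2`.
  two-in-class : ∀ {x y z} → x ≢ y → cls x ≡ cls y → cls z ≡ cls x → z ≡ x ⊎ z ≡ y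
  two-in-class {x} {y} {z} x≢y xy zx =
    go (bit x) (bit y) (bit z) refl refl refl
    where
    go : ∀ a b c → bit x ≡ a → bit y ≡ b → bit z ≡ c → z ≡ x ⊎ z ≡ y
    go zero       zero       _          a b _ = contradiction (bit-cls-injective (trans a (sym b)) xy) x≢y
    go (suc zero) (suc zero) _          a b _ = contradiction (bit-cls-injective (trans a (sym b)) xy) x≢y
    go zero       (suc zero) zero       a _ c = inj₁ (bit-cls-injective (trans c (sym a)) zx)
    go (suc zero) zero       (suc zero) a _ c = inj₁ (bit-cls-injective (trans c (sym a)) zx)
    go zero       (suc zero) (suc zero) _ b c = inj₂ (bit-cls-injective (trans c (sym b)) (trans zx xy))
    go (suc zero) zero       zero       _ b c = inj₂ (bit-cls-injective (trans c (sym b)) (trans zx xy))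

  ∈-class⁻ : ∀ {x i} → x ∈ₛ class i → cls x ≡ i
  ∈-class⁻ {x} {i} x∈ with x∈p∪q⁻ ⁅ vertex zero i ⁆ ⁅ vertex (suc zero) i ⁆ x∈
  ... | inj₁ x∈₀ = trans (cong cls (x∈⁅y⁆⇒x≡y _ x∈₀)) (cls-vertex zero i)
  ... | inj₂ x∈₁ = trans (cong cls (x∈⁅y⁆⇒x≡y _ x∈₁)) (cls-vertex (suc zero) i)

  ∈-class⁺ : ∀ {x i} → cls x ≡ i → x ∈ₛ class i
  ∈-class⁺ {x} {i} refl
    with two-in-class {vertex zero i} {vertex (suc zero) i} {x} (vertex₀≢vertex₁ i)
           (trans (cls-vertex zero i) (sym (cls-vertex (suc zero) i))) (sym (cls-vertex zero i))
  ... | inj₁ eq = x∈p∪q⁺ (inj₁ (subst (_∈ₛ ⁅ vertex zero i ⁆) (sym eq) (x∈⁅x⁆ _)))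
  ... | inj₂ eq = x∈p∪q⁺ (inj₂ (subst (_∈ₛ ⁅ vertex (suc zero) i ⁆) (sym eq) (x∈⁅x⁆ _)))

  -- All edges in the obstructions are built this way: a full class `x`, `y`, then one vertex `ws`
  -- from each of `s` further classes.
  fromList-edge : ∀ {x y ws s} → x ≢ y → cls x ≡ cls y → Unique (cls x ∷ map cls ws) → length ws ≡ s →
                  Edge (ℋ n (2 + s)) (fromList (x ∷ y ∷ ws))
  fromList-edge {x} {y} {ws} x≢y xy u@(_ ∷ u′) refl =
    ∣fromList∣ ((x≢y ∷ fresh refl) ∷ fresh (sym xy) ∷ Unique.map⁻ u′) ,
    cls x ,
    trans (cong ∣_∣ (⊆-antisym (p∩q⊆q e (class (cls x))) class⊆)) (∣⁅x⁆∪⁅y⁆∣≡2 (vertex₀≢vertex₁ (cls x))) ,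
    λ j j≢ → injectiveOn⇒∣p∣≤ (e ∩ class j) (λ _ → zero) λ z∈ w∈ _ →
      unique-in j j≢ (x∈p∩q⁻ e (class j) z∈) (x∈p∩q⁻ e (class j) w∈)
    where
    e : Subset (2 * n)
    e = fromList (x ∷ y ∷ ws)

    fresh : ∀ {z} → cls z ≡ cls x → All (z ≢_) ws
    fresh zx = All.tabulate λ w∈ z≡w → Unique.Unique[x∷xs]⇒x∉xs u
      (subst (_∈ map cls ws) (trans (cong cls (sym z≡w)) zx) (∈-map⁺ cls w∈))

    class⊆ : ∀ {z} → z ∈ₛ class (cls x) → z ∈ₛ e ∩ class (cls x)
    class⊆ z∈ with two-in-class x≢y xy (∈-class⁻ z∈)
    ... | inj₁ refl = x∈p∩q⁺ (∈-fromList⁺ {xs = x ∷ y ∷ ws} (here refl) , z∈)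
    ... | inj₂ refl = x∈p∩q⁺ (∈-fromList⁺ {xs = x ∷ y ∷ ws} (there (here refl)) , z∈)

    cls-injectiveOn : ∀ {us : List (Fin (2 * n))} → Unique (map cls us) →
                      ∀ {z w} → z ∈ us → w ∈ us → cls z ≡ cls w → z ≡ w
    cls-injectiveOn _        (here refl) (here refl) _  = refl
    cls-injectiveOn u        (here refl) (there w∈)  eq =
      contradiction (subst (_∈ _) (sym eq) (∈-map⁺ cls w∈)) (Unique.Unique[x∷xs]⇒x∉xs u)
    cls-injectiveOn u        (there z∈)  (here refl) eq =
      contradiction (subst (_∈ _) eq (∈-map⁺ cls z∈)) (Unique.Unique[x∷xs]⇒x∉xs u)
    cls-injectiveOn (_ ∷ u)  (there z∈)  (there w∈)  eq = cls-injectiveOn u z∈ w∈ eq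

    outside-double : ∀ {z j} → j ≢ cls x → z ∈ₛ e × z ∈ₛ class j → z ∈ ws
    outside-double j≢ (z∈e , z∈j) with ∈-fromList⁻ (x ∷ y ∷ ws) z∈e
    ... | here refl         = contradiction (sym (∈-class⁻ z∈j)) j≢
    ... | there (here refl) = contradiction (trans (sym (∈-class⁻ z∈j)) (sym xy)) j≢
    ... | there (there z∈)  = z∈

    unique-in : ∀ j → j ≢ cls x → ∀ {z w} → z ∈ₛ e × z ∈ₛ class j → w ∈ₛ e × w ∈ₛ class j → z ≡ w
    unique-in j j≢ z∈ w∈ = cls-injectiveOn u′ (outside-double j≢ z∈) (outside-double j≢ w∈)
      (trans (∈-class⁻ (proj₂ z∈)) (sym (∈-class⁻ (proj₂ w∈))))

-- Colourings: parts (2) and (4)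

module _ {n : ℕ} {e : Subset (2 * n)} where

  open Classes n

  -- If one vertex of the class were missing from `e`, the intersection would have at most one
  -- element.
  double-class⊆ : ∀ {i : Fin n} → ∣ e ∩ class i ∣ ≡ 2 → ∀ {x} → cls x ≡ i → x ∈ₛ e
  double-class⊆ {i} ≡2 {x} xi with x ∈? e
  ... | yes x∈e = x∈e
  ... | no  x∉e = contradiction
    (subst (_≤ 1) ≡2 (injectiveOn⇒∣p∣≤ {m = 1} (e ∩ class i) (λ _ → zero) λ z∈ w∈ _ → same z∈ w∈))
    λ { (s≤s ()) }
    where
    same : ∀ {z w} → z ∈ₛ e ∩ class i → w ∈ₛ e ∩ class i → z ≡ w
    same {z} {w} z∈ w∈ with z ≟ w | x∈p∩q⁻ e (class i) z∈ | x∈p∩q⁻ e (class i) w∈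
    ... | yes z≡w | _ | _ = z≡w
    ... | no  z≢w | z∈e , z∈i | w∈e , w∈i
      with two-in-class z≢w (trans (∈-class⁻ z∈i) (sym (∈-class⁻ w∈i))) (trans xi (sym (∈-class⁻ z∈i)))
    ... | inj₁ refl = contradiction z∈e x∉e
    ... | inj₂ refl = contradiction w∈e x∉e

  -- An edge meets `1 + s` classes, so a map that separates them needs that many values. Both
  -- colourings use `m = s`: there a forbidden edge would yield `1 + s ≤ s`.
  edge-classes≤ : ∀ {s m} → Edge (ℋ n (2 + s)) e → (f : Fin (2 * n) → Fin m) →
                  (∀ {x y} → x ∈ₛ e → y ∈ₛ e → f x ≡ f y → cls x ≡ cls y) → 1 + s ≤ m
  edge-classes≤ {m = m} (∣e∣≡ , i , _ , ≤1) f f-inj = ℕ.≤-pred (subst (_≤ suc m) ∣e∣≡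
    (injectiveOn⇒∣p∣≤ e (λ x → g x (x ≟ v)) λ x∈ y∈ → g-inj x∈ y∈ (_ ≟ v) (_ ≟ v)))
    where
    v : Fin (2 * n)
    v = vertex zero i

    -- f may take the same value at both vertices of the double class, so one of them gets a value of its own.
    g : ∀ x → Dec (x ≡ v) → Fin (suc m)
    g x (yes _) = zero
    g x (no _)  = suc (f x)

    same-class : ∀ {x y} → x ≢ v → y ≢ v → x ∈ₛ e → y ∈ₛ e → cls x ≡ cls y → x ≡ y
    same-class {x} {y} x≢v y≢v x∈ y∈ xy with cls x ≟ i
    ... | no  x≢i = ∣p∣≤1⇒≡ (≤1 _ x≢i) (x∈p∩q⁺ (x∈ , ∈-class⁺ refl)) (x∈p∩q⁺ (y∈ , ∈-class⁺ (sym xy)))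
    ... | yes x≡i
      with two-in-class (x≢v ∘ sym) (trans (cls-vertex zero i) (sym x≡i))
             (trans (sym xy) (trans x≡i (sym (cls-vertex zero i))))
    ...   | inj₁ y≡v = contradiction y≡v y≢v
    ...   | inj₂ y≡x = sym y≡x

    g-inj : ∀ {x y} → x ∈ₛ e → y ∈ₛ e → (dx : Dec (x ≡ v)) (dy : Dec (y ≡ v)) → g x dx ≡ g y dy → x ≡ y
    g-inj x∈ y∈ (yes refl) (yes refl) _  = refl
    g-inj x∈ y∈ (yes _)    (no _)     ()
    g-inj x∈ y∈ (no _)     (yes _)    ()
    g-inj x∈ y∈ (no x≢v)   (no y≢v)   eq =
      same-class x≢v y≢v x∈ y∈ (f-inj x∈ y∈ (suc-injective eq))

-- Rounded-up quotients

⌈/⌉≤⇒≤* : ∀ {n s k} .{{_ : NonZero s}} → ⌈ n / s ⌉ ≤ k → n ≤ s * k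
⌈/⌉≤⇒≤* {n} {s@(suc s′)} {k} ⌈n/s⌉≤k = ℕ.≮⇒≥ λ s*k<n → ℕ.<⇒≱ (begin
    suc k            ≡⟨ m*n/n≡m (suc k) s ⟨
    suc k * s / s    ≤⟨ /-monoˡ-≤ s (begin
      suc s′ + k * s    ≡⟨ ℕ.+-comm (suc s′) (k * s) ⟩
      k * s + suc s′    ≡⟨ ℕ.+-suc (k * s) s′ ⟩
      suc (k * s) + s′  ≡⟨ cong (λ m → suc m + s′) (ℕ.*-comm k s) ⟩
      suc (s * k) + s′  ≤⟨ ℕ.+-monoˡ-≤ s′ s*k<n ⟩
      n + s′            ∎) ⟩
    ⌈ n / s ⌉        ∎) ⌈n/s⌉≤k
  where open ℕ.≤-Reasoning

<⌈/⌉⇒*< : ∀ {n s k} .{{_ : NonZero s}} → k < ⌈ n / s ⌉ → k * s < n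
<⌈/⌉⇒*< {n} {s@(suc s′)} {k} k<⌈n/s⌉ = ℕ.≰⇒> λ n≤k*s → ℕ.<⇒≱ k<⌈n/s⌉ (ℕ.≤-pred
  (m<n*o⇒m/o<n {n + s′} {suc k} {s} (begin-strict
    n + s′      ≤⟨ ℕ.+-monoˡ-≤ s′ n≤k*s ⟩
    k * s + s′  <⟨ ℕ.+-monoʳ-< (k * s) (ℕ.n<1+n s′) ⟩
    k * s + s   ≡⟨ ℕ.+-comm (k * s) s ⟩
    suc k * s   ∎)))
  where open ℕ.≤-Reasoning

-- The colour of a class is its index modulo `k`. A rainbow edge is impossible because its double
-- class has one colour. On a monochromatic edge the remainder is fixed, so the quotient by `k`,
-- which is below `s` since `n ≤ s * k`, determines the class.
colourable-mod : ∀ {n s k} .{{_ : NonZero s}} →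
                 ⌈ n / s ⌉ ≤ k → 1 ≤ k → k ≤ n → NMNRColourable (ℋ n (2 + s)) k
colourable-mod {n} {s} {k} ⌈n/s⌉≤k 1≤k k≤n = record
  { colour           = colour
  ; surjective       = λ γ → vertex zero (inject≤ γ k≤n) , λ { refl → surj γ }
  ; nonMonochromatic = λ e edge mono → ℕ.1+n≰n (edge-classes≤ edge quotient (mono⇒cls mono))
  ; nonRainbow       = λ { e (_ , i , ≡2 , _) rainbow → vertex₀≢vertex₁ i
      (rainbow (double-class⊆ ≡2 (cls-vertex zero i)) (double-class⊆ ≡2 (cls-vertex (suc zero) i))
        (cong (λ j → toℕ j mod k) (trans (cls-vertex zero i) (sym (cls-vertex (suc zero) i))))) }
  }
  where
  open Classes n

  instance
    k≢0 : NonZero k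
    k≢0 = >-nonZero 1≤k

  colour : Fin (2 * n) → Fin k
  colour x = toℕ (cls x) mod k

  surj : ∀ γ → colour (vertex zero (inject≤ γ k≤n)) ≡ γ
  surj γ = toℕ-injective (begin
    toℕ (colour (vertex zero (inject≤ γ k≤n)))   ≡⟨ toℕ-fromℕ< _ ⟩
    toℕ (cls (vertex zero (inject≤ γ k≤n))) % k  ≡⟨ cong (λ j → toℕ j % k) (cls-vertex zero (inject≤ γ k≤n)) ⟩
    toℕ (inject≤ γ k≤n) % k                      ≡⟨ cong (_% k) (toℕ-inject≤ γ k≤n) ⟩
    toℕ γ % k                                    ≡⟨ m<n⇒m%n≡m (toℕ<n γ) ⟩
    toℕ γ                                        ∎)
    where open ≡-Reasoning

  quotient : Fin (2 * n) → Fin s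
  quotient x = fromℕ< (m<n*o⇒m/o<n {toℕ (cls x)} {s} {k} (ℕ.<-≤-trans (toℕ<n (cls x)) (⌈/⌉≤⇒≤* ⌈n/s⌉≤k)))

  mono⇒cls : ∀ {e} → Monochromatic colour e →
             ∀ {x y} → x ∈ₛ e → y ∈ₛ e → quotient x ≡ quotient y → cls x ≡ cls y
  mono⇒cls mono {x} {y} x∈ y∈ eq = toℕ-injective (begin
    toℕ (cls x)                                      ≡⟨ m≡m%n+[m/n]*n (toℕ (cls x)) k ⟩
    toℕ (cls x) % k + toℕ (cls x) / k * k            ≡⟨ cong₂ (λ a b → a + b * k) rem quo ⟩
    toℕ (cls y) % k + toℕ (cls y) / k * k            ≡⟨ m≡m%n+[m/n]*n (toℕ (cls y)) k ⟨
    toℕ (cls y)                                      ∎)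
    where
    open ≡-Reasoning
    rem : toℕ (cls x) % k ≡ toℕ (cls y) % k
    rem = trans (sym (toℕ-fromℕ< _)) (trans (cong toℕ (mono x∈ y∈)) (toℕ-fromℕ< _))
    quo : toℕ (cls x) / k ≡ toℕ (cls y) / k
    quo = trans (sym (toℕ-fromℕ< _)) (trans (cong toℕ eq) (toℕ-fromℕ< _))

-- No class is monochromatic, hence no edge is. On a rainbow edge `f` separates the classes and has
-- only `s` values: two for the default colours and one for each of at most `s - 2` special classes.
colourable-few : ∀ {n s k} → s ≤ n → 2 ≤ k → 2 + k ≤ 2 * s → NMNRColourable (ℋ n (2 + s)) k
colourable-few {n} {s} {k} s≤n 2≤k 2+k≤2s = record
  { colour           = colour
  ; surjective       = λ γ → let x , x≡ = preimage γ in x , λ { refl → x≡ }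
  ; nonMonochromatic = λ { e (_ , i , ≡2 , _) mono → bichromatic i
      (mono (double-class⊆ ≡2 (cls-vertex zero i)) (double-class⊆ ≡2 (cls-vertex (suc zero) i))) }
  ; nonRainbow       = λ e edge rainbow → ℕ.1+n≰n (edge-classes≤ edge f (rainbow⇒cls rainbow))
  }
  where
  open Classes n

  -- Special vertices get the colours ≥ 2 in turn, all others the bit.
  fresh : Fin 2 → Fin n → ℕ
  fresh b j = 2 + (toℕ b + toℕ j * 2)

  Special : Fin 2 → Fin n → Set
  Special b j = fresh b j < k

  special? : ∀ b j → Dec (Special b j)
  special? b j = fresh b j ℕ.<? k

  pick : ∀ b j → Dec (Special b j) → Fin k
  pick b j (yes fresh<k) = fromℕ< fresh<k
  pick b j (no _)        = inject≤ b 2≤k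

  colour : Fin (2 * n) → Fin k
  colour x = pick (bit x) (cls x) (special? (bit x) (cls x))

  colour-vertex : ∀ b j → colour (vertex b j) ≡ pick b j (special? b j)
  colour-vertex b j = cong₂ (λ b j → pick b j (special? b j)) (bit-vertex b j) (cls-vertex b j)

  2+2j<k⇒ : ∀ {j} → 2 + j * 2 < k → 2 + j < s
  2+2j<k⇒ {j} lt = ℕ.*-cancelʳ-< 2 (2 + j) s (begin-strict
    4 + j * 2        <⟨ s≤s (s≤s lt) ⟩
    2 + k            ≤⟨ 2+k≤2s ⟩
    2 * s            ≡⟨ ℕ.*-comm 2 s ⟩
    s * 2            ∎)
    where open ℕ.≤-Reasoning

  special⇒< : ∀ {b j} → Special b j → 2 + toℕ j < s
  special⇒< {b} {j} sp = 2+2j<k⇒ {toℕ j} (ℕ.≤-<-trans (ℕ.+-monoʳ-≤ 2 (ℕ.m≤n+m (toℕ j * 2) (toℕ b))) sp)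

  2≤s : 2 ≤ s
  2≤s = ℕ.*-cancelˡ-≤ 2 (ℕ.≤-trans (ℕ.+-monoʳ-≤ 2 2≤k) 2+k≤2s)

  -- An edge that repeats neither colour 0 nor colour 1 has at most one class for each value of f.
  f′ : ∀ b j → Dec (Special b j) → Fin s
  f′ b j (yes sp) = fromℕ< (special⇒< {b} {j} sp)
  f′ b j (no _)   = inject≤ b 2≤s

  f : Fin (2 * n) → Fin s
  f x = f′ (bit x) (cls x) (special? (bit x) (cls x))

  -- Two fresh colours in a class differ by one, fresh colours are at least 2, and default colours
  -- are the bits themselves.
  pick-differs : ∀ i (d₀ : Dec (Special zero i)) (d₁ : Dec (Special (suc zero) i)) →
                 toℕ (pick zero i d₀) ≢ toℕ (pick (suc zero) i d₁)
  pick-differs i (yes p) (yes q) eq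
    with () ← ℕ.1+n≢n (trans (sym (toℕ-fromℕ< q)) (trans (sym eq) (toℕ-fromℕ< p)))
  pick-differs i (yes p) (no _)  eq
    with () ← trans (sym (toℕ-fromℕ< p)) (trans eq (toℕ-inject≤ (suc zero) 2≤k))
  pick-differs i (no _)  (yes q) eq
    with () ← trans (sym (toℕ-fromℕ< q)) (trans (sym eq) (toℕ-inject≤ zero 2≤k))
  pick-differs i (no _)  (no _)  eq
    with () ← trans (sym (toℕ-inject≤ zero 2≤k)) (trans eq (toℕ-inject≤ (suc zero) 2≤k))

  bichromatic : ∀ i → colour (vertex zero i) ≢ colour (vertex (suc zero) i)
  bichromatic i eq = pick-differs i (special? zero i) (special? (suc zero) i)
    (cong toℕ (trans (sym (colour-vertex zero i)) (trans eq (colour-vertex (suc zero) i))))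

  rainbow⇒cls : ∀ {e} → Rainbow colour e →
                ∀ {x y} → x ∈ₛ e → y ∈ₛ e → f x ≡ f y → cls x ≡ cls y
  rainbow⇒cls rainbow {x} {y} x∈ y∈ eq =
    go (special? (bit x) (cls x)) (special? (bit y) (cls y)) refl refl (cong toℕ eq)
    where
    2+m≢bit : ∀ {m} (b : Fin 2) → 2 + m ≢ toℕ b
    2+m≢bit b eq = ℕ.<⇒≢ (ℕ.<-≤-trans (toℕ<n b) (ℕ.m≤m+n 2 _)) (sym eq)

    go : (dx : Dec (Special (bit x) (cls x))) (dy : Dec (Special (bit y) (cls y))) →
         colour x ≡ pick (bit x) (cls x) dx → colour y ≡ pick (bit y) (cls y) dy →
         toℕ (f′ (bit x) (cls x) dx) ≡ toℕ (f′ (bit y) (cls y) dy) → cls x ≡ cls y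
    go (yes p) (yes q) _ _ eq = toℕ-injective (ℕ.+-cancelˡ-≡ 2 _ _
      (trans (sym (toℕ-fromℕ< _)) (trans eq (toℕ-fromℕ< _))))
    go (yes p) (no _)  _ _ eq = contradiction
      (trans (sym (toℕ-fromℕ< _)) (trans eq (toℕ-inject≤ (bit y) 2≤s))) (2+m≢bit (bit y))
    go (no _)  (yes q) _ _ eq = contradiction
      (trans (sym (toℕ-fromℕ< _)) (trans (sym eq) (toℕ-inject≤ (bit x) 2≤s))) (2+m≢bit (bit x))
    go (no _)  (no _)  cx cy eq = cong cls (rainbow x∈ y∈
      (trans cx (trans (cong (λ b → inject≤ b 2≤k) bx≡by) (sym cy))))
      where
      bx≡by : bit x ≡ bit y
      bx≡by = toℕ-injective (trans (sym (toℕ-inject≤ (bit x) 2≤s)) (trans eq (toℕ-inject≤ (bit y) 2≤s)))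

  pick-special : ∀ {b j γ} (d : Dec (Special b j)) → fresh b j ≡ toℕ γ → pick b j d ≡ γ
  pick-special         (yes p) eq = toℕ-injective (trans (toℕ-fromℕ< p) eq)
  pick-special {γ = γ} (no ¬p) eq = contradiction (subst (_< k) (sym eq) (toℕ<n γ)) ¬p

  pick-default : ∀ {b j γ} (d : Dec (Special b j)) → ¬ Special b j → toℕ b ≡ toℕ γ → pick b j d ≡ γ
  pick-default     (yes p) ¬p eq = contradiction p ¬p
  pick-default {b} (no _)  _  eq = toℕ-injective (trans (toℕ-inject≤ b 2≤k) eq)

  preimage : ∀ γ → ∃ λ x → colour x ≡ γ
  preimage γ with toℕ γ ℕ.<? 2
  -- The witness lies in class `s - 1`, which is too late to be special, so both of its vertices
  -- have default colours.
  ... | yes γ<2 = vertex b j , trans (colour-vertex b j)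
    (pick-default {b} {j} (special? b j) (λ sp → ℕ.<⇒≱ (special⇒< {b} {j} sp) s≤2+j) (toℕ-fromℕ< γ<2))
    where
    b : Fin 2
    b = fromℕ< γ<2
    s-1<n : s ∸ 1 < n
    s-1<n = ℕ.≤-trans (ℕ.≤-reflexive (ℕ.m+[n∸m]≡n (ℕ.<⇒≤ 2≤s))) s≤n
    j : Fin n
    j = fromℕ< s-1<n
    s≤2+j : s ≤ 2 + toℕ j
    s≤2+j = begin
      s            ≡⟨ ℕ.m+[n∸m]≡n (ℕ.<⇒≤ 2≤s) ⟨
      1 + (s ∸ 1)  ≤⟨ ℕ.n≤1+n _ ⟩
      2 + (s ∸ 1)  ≡⟨ cong (2 +_) (toℕ-fromℕ< s-1<n) ⟨
      2 + toℕ j    ∎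
      where open ℕ.≤-Reasoning
  -- The remainder and the quotient of `toℕ γ - 2` by 2 invert `fresh`.
  ... | no γ≮2 = vertex b j , trans (colour-vertex b j) (pick-special {b} {j} (special? b j) fresh≡γ)
    where
    m : ℕ
    m = toℕ γ ∸ 2
    2+m≡γ : 2 + m ≡ toℕ γ
    2+m≡γ = ℕ.m+[n∸m]≡n (ℕ.≮⇒≥ γ≮2)
    m/2<n : m / 2 < n
    m/2<n = ℕ.<-≤-trans (ℕ.≤-<-trans (ℕ.m≤n+m (m / 2) 2) (2+2j<k⇒ {m / 2} (begin-strict
      2 + m / 2 * 2  ≤⟨ ℕ.+-monoʳ-≤ 2 (m/n*n≤m m 2) ⟩
      2 + m          ≡⟨ 2+m≡γ ⟩
      toℕ γ          <⟨ toℕ<n γ ⟩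
      k              ∎))) s≤n
      where open ℕ.≤-Reasoning
    b : Fin 2
    b = m mod 2
    j : Fin n
    j = fromℕ< m/2<n
    fresh≡γ : fresh b j ≡ toℕ γ
    fresh≡γ = begin
      2 + (toℕ b + toℕ j * 2)    ≡⟨ cong₂ (λ a q → 2 + (a + q * 2)) (toℕ-fromℕ< (m%n<n m 2)) (toℕ-fromℕ< m/2<n) ⟩
      2 + (m % 2 + m / 2 * 2)    ≡⟨ cong (2 +_) (m≡m%n+[m/n]*n m 2) ⟨
      2 + m                      ≡⟨ 2+m≡γ ⟩
      toℕ γ                      ∎
      where open ≡-Reasoning

-- Obstructions: parts (1) and (3)

preimages : ∀ {a b} {A : Set a} {B : Set b} {g : A → B} {ys} →
            All (λ y → ∃ λ x → g x ≡ y) ys → ∃ λ xs → map g xs ≡ ys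
preimages []               = [] , refl
preimages ((x , refl) ∷ p) with xs , refl ← preimages p = x ∷ xs , refl

length-allFin : ∀ n → length (allFin n) ≡ n
length-allFin n = length-tabulate {n = n} (λ i → i)

module NonColourable {n s k : ℕ} (C : NMNRColouring (ℋ n (2 + s)) k) where

  open Classes n
  open NMNRColouring C renaming (colour to c)

  -- One class of `U` taken in full and one vertex from each of `s` others form a monochromatic
  -- edge.
  same-colour⇒⊥ : ∀ {U} → Unique U → s < length U →
                  (∀ {j j′} → j ∈ U → j′ ∈ U → ∀ b b′ → c (vertex b j) ≡ c (vertex b′ j′)) → ⊥
  same-colour⇒⊥ {j ∷ U} (j∉U ∷ u) (s≤s s≤) same = nonMonochromatic (fromList (x ∷ y ∷ ws))
    (fromList-edge (vertex₀≢vertex₁ j) (trans (cls-vertex zero j) (sym (cls-vertex (suc zero) j)))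
      (subst Unique (cong₂ _∷_ (sym (cls-vertex zero j)) (sym cls-ws)) (All.take⁺ s j∉U ∷ Unique.take⁺ s u))
      (trans (length-map (vertex zero) (take s U)) (trans (length-take s U) (ℕ.m≤n⇒m⊓n≡m s≤))))
    λ x∈ y∈ → mono (∈-fromList⁻ (x ∷ y ∷ ws) x∈) (∈-fromList⁻ (x ∷ y ∷ ws) y∈)
    where
    x y : Fin (2 * n)
    x = vertex zero j
    y = vertex (suc zero) j

    ws : List (Fin (2 * n))
    ws = map (vertex zero) (take s U)

    cls-ws : map cls ws ≡ take s U
    cls-ws = trans (sym (map-∘ (take s U))) (trans (map-cong (cls-vertex zero) (take s U)) (map-id (take s U)))

    class∈ : ∀ {z} → z ∈ x ∷ y ∷ ws → ∃ λ b → ∃ λ i → i ∈ j ∷ U × z ≡ vertex b i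
    class∈ (here refl)         = zero , j , here refl , refl
    class∈ (there (here refl)) = suc zero , j , here refl , refl
    class∈ (there (there z∈)) with i , i∈ , refl ← ∈-map⁻ (vertex zero) z∈ =
      zero , i , there (subst (i ∈_) (take++drop≡id s U) (∈-++⁺ˡ i∈)) , refl

    mono : ∀ {z w} → z ∈ x ∷ y ∷ ws → w ∈ x ∷ y ∷ ws → c z ≡ c w
    mono z∈ w∈ with b , i , i∈ , refl ← class∈ z∈ | b′ , i′ , i′∈ , refl ← class∈ w∈ = same i∈ i′∈ b b′

  -- A section selects one vertex of each colour, so every edge inside its image is rainbow.
  Section : (Fin k → Fin (2 * n)) → Set
  Section t = ∀ γ → c (t γ) ≡ γ

  Meets : (Fin k → Fin (2 * n)) → Fin n → Set
  Meets t j = ∃ λ γ → cls (t γ) ≡ j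

  -- The two vertices `t γ`, `t δ` fill a class. With them go the vertices of colours `G`, chosen so
  -- that they lie in `s` different classes of `U` other than that one.
  double-section⇒⊥ : ∀ {t} → Section t → ∀ {γ δ} → γ ≢ δ → cls (t γ) ≡ cls (t δ) →
                     ∀ {U} → Unique U → s < length U → (∀ {j} → j ∈ U → Meets t j) → ⊥
  double-section⇒⊥ {t} ct {γ} {δ} γ≢δ γδ {U} u s<U meets =
    go (preimages (All.tabulate λ j∈ → meets (proj₁ (∈-filter⁻ ≢i? (take⊆ j∈)))))
    where
    i : Fin n
    i = cls (t γ)

    ≢i? : ∀ j → Dec (j ≢ i)
    ≢i? j = ¬? (j ≟ i)

    U⁻ : List (Fin n)
    U⁻ = filter ≢i? U

    take⊆ : take s U⁻ ⊆ U⁻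
    take⊆ {j} j∈ = subst (j ∈_) (take++drop≡id s U⁻) (∈-++⁺ˡ j∈)

    U⊆ : U ⊆ i ∷ U⁻
    U⊆ {j} j∈ with j ≟ i
    ... | yes j≡i = here j≡i
    ... | no  j≢i = there (∈-filter⁺ ≢i? j∈ j≢i)

    s≤U⁻ : s ≤ length U⁻
    s≤U⁻ = ℕ.≤-pred (ℕ.≤-trans s<U (unique-⊆⇒length≤ u U⊆))

    go : (∃ λ G → map (cls ∘ t) G ≡ take s U⁻) → ⊥
    go (G , G≡) = nonRainbow (fromList (t γ ∷ t δ ∷ map t G))
      (fromList-edge (λ eq → γ≢δ (trans (sym (ct γ)) (trans (cong c eq) (ct δ)))) γδ
        (subst Unique (cong (i ∷_) (sym cls-tG))
          (All.tabulate (λ j∈ i≡j → proj₂ (∈-filter⁻ ≢i? {xs = U} (take⊆ j∈)) (sym i≡j))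
            ∷ Unique.take⁺ s (Unique.filter⁺ ≢i? u)))
        (begin
          length (map t G)          ≡⟨ length-map t G ⟩
          length G                  ≡⟨ length-map (cls ∘ t) G ⟨
          length (map (cls ∘ t) G)  ≡⟨ cong length G≡ ⟩
          length (take s U⁻)        ≡⟨ length-take s U⁻ ⟩
          s ⊓ length U⁻             ≡⟨ ℕ.m≤n⇒m⊓n≡m s≤U⁻ ⟩
          s                         ∎))
      -- On the image of `t`, the composite of `c` followed by `t` is the identity, so `c` is
      -- injective there.
      λ x∈ y∈ eq → trans (sym (tc x∈)) (trans (cong t eq) (tc y∈))
      where
      open ≡-Reasoning
      cls-tG : map cls (map t G) ≡ take s U⁻
      cls-tG = trans (sym (map-∘ G)) G≡

      tc : ∀ {x} → x ∈ₛ fromList (t γ ∷ t δ ∷ map t G) → t (c x) ≡ x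
      tc x∈ with ∈-fromList⁻ (map t (γ ∷ δ ∷ G)) x∈
      ... | x∈tG with η , _ , refl ← ∈-map⁻ t {xs = γ ∷ δ ∷ G} x∈tG = cong t (ct η)

  -- Moves the representative of the colour of `z` to `z` itself, so a section stays a section.
  override : (Fin k → Fin (2 * n)) → Fin (2 * n) → Fin k → Fin (2 * n)
  override t z γ with γ ≟ c z
  ... | yes _ = z
  ... | no _  = t γ

  override-at : ∀ t z → override t z (c z) ≡ z
  override-at t z with c z ≟ c z
  ... | yes _  = refl
  ... | no c≢c = contradiction refl c≢c

  override-off : ∀ t z {γ} → γ ≢ c z → override t z γ ≡ t γ
  override-off t z {γ} γ≢ with γ ≟ c z
  ... | yes γ≡ = contradiction γ≡ γ≢
  ... | no _   = refl

  override-section : ∀ {t} → Section t → ∀ z → Section (override t z)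
  override-section ct z γ with γ ≟ c z
  ... | yes γ≡ = sym γ≡
  ... | no _   = ct γ

  length≤2* : ∀ {xs P} → Unique xs → (∀ {x} → x ∈ xs → cls x ∈ P) → length xs ≤ 2 * length P
  length≤2* {xs} {P} u cls∈ = ℕ.≤-trans
    (unique-⊆⇒length≤ {ys = map (vertex zero) P ++ map (vertex (suc zero)) P} u
      λ {x} x∈ → subst (_∈ _) (vertex-bit-cls x) (vertex∈ (bit x) (cls∈ x∈)))
    (ℕ.≤-reflexive (trans (length-++ (map (vertex zero) P))
      (cong₂ _+_ (length-map (vertex zero) P) (trans (length-map (vertex (suc zero)) P) (sym (ℕ.+-identityʳ _))))))
    where
    vertex∈ : ∀ b {j} → j ∈ P → vertex b j ∈ map (vertex zero) P ++ map (vertex (suc zero)) P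
    vertex∈ zero       j∈ = ∈-++⁺ˡ (∈-map⁺ (vertex zero) j∈)
    vertex∈ (suc zero) j∈ = ∈-++⁺ʳ (map (vertex zero) P) (∈-map⁺ (vertex (suc zero)) j∈)

  -- Sections that use both vertices of some class

  module _ (3≤s : 3 ≤ s) (2s≤1+k : 2 * s ≤ 1 + k) (2s<n : 2 * s < n)
           {t} (ct : Section t) {γ₀ δ₀} (γ₀≢δ₀ : γ₀ ≢ δ₀) (γ₀δ₀ : cls (t γ₀) ≡ cls (t δ₀)) where

    meets? : ∀ j → Dec (Meets t j)
    meets? j = any? λ γ → cls (t γ) ≟ j

    P O : List (Fin n)
    P = filter meets? (allFin n)
    O = filter (¬? ∘ meets?) (allFin n)

    P-unique : Unique P
    P-unique = Unique.filter⁺ meets? (Unique.allFin⁺ n)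

    P-meets : ∀ {j} → j ∈ P → Meets t j
    P-meets j∈ = proj₂ (∈-filter⁻ meets? {xs = allFin n} j∈)

    meets-P : ∀ γ → cls (t γ) ∈ P
    meets-P γ = ∈-filter⁺ meets? (∈-allFin _) (γ , refl)

    t-injective : ∀ {γ δ} → t γ ≡ t δ → γ ≡ δ
    t-injective eq = trans (sym (ct _)) (trans (cong c eq) (ct _))

    t-all : List (Fin (2 * n))
    t-all = map t (allFin k)

    length-t-all : length t-all ≡ k
    length-t-all = trans (length-map t (allFin k)) (length-allFin k)

    t-all-unique : Unique t-all
    t-all-unique = Unique.map⁺ t-injective (Unique.allFin⁺ k)

    t-all∈P : ∀ {x} → x ∈ t-all → cls x ∈ P
    t-all∈P x∈ with γ , _ , refl ← ∈-map⁻ t x∈ = meets-P γ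

    -- The `k` distinct vertices of the section fit into `length P` classes of size 2. With fewer
    -- than `s` classes this would give `k ≤ 2s - 2`, one below the assumed bound.
    s≤P : s ≤ length P
    s≤P = ℕ.≮⇒≥ λ P<s → ℕ.1+n≰n (begin
      suc (1 + 2 * length P)  ≡⟨ ℕ.*-suc 2 (length P) ⟨
      2 * suc (length P)      ≤⟨ ℕ.*-monoʳ-≤ 2 P<s ⟩
      2 * s                   ≤⟨ 2s≤1+k ⟩
      1 + k                   ≡⟨ cong suc length-t-all ⟨
      1 + length t-all        ≤⟨ s≤s (length≤2* t-all-unique t-all∈P) ⟩
      1 + 2 * length P        ∎)
      where open ℕ.≤-Reasoning

    P≤s : length P ≤ s
    P≤s = ℕ.≮⇒≥ λ s<P → double-section⇒⊥ ct γ₀≢δ₀ γ₀δ₀ P-unique s<P P-meets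

    Double : Fin k → Set
    Double γ = ∃ λ η → η ≢ γ × cls (t η) ≡ cls (t γ)

    -- Room for the pigeonhole principle after one more class is met: `3 ≤ s` gives `3 + s ≤ 2 * s`.
    1+P<k : suc (length P) < k
    1+P<k = ℕ.≤-pred (begin
      3 + length P   ≤⟨ ℕ.+-mono-≤ 3≤s P≤s ⟩
      s + s          ≡⟨ cong (s +_) (ℕ.+-identityʳ s) ⟨
      2 * s          ≤⟨ 2s≤1+k ⟩
      suc k          ∎)
      where open ℕ.≤-Reasoning

    -- Otherwise the representative of that colour can be moved to `vertex b j` while its old class
    -- stays met. The new section meets at least `s + 1` classes, and having more colours than
    -- classes it uses some class twice.
    outside-single : ∀ {j} → ¬ Meets t j → ∀ b → ¬ Double (c (vertex b j))
    outside-single {j} ¬meets b (η , η≢ , ηα) =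
      let γ , δ , γ<δ , eq = pigeonhole 1+P<k (Any.index ∘ class∈) in
      double-section⇒⊥ (override-section ct z) (<⇒≢ γ<δ)
        (index-injective (setoid (Fin n)) (class∈ γ) (class∈ δ) eq)
        {j ∷ P} (All.tabulate (λ { i∈ refl → ¬meets (P-meets i∈) }) ∷ P-unique) (s≤s s≤P) meets
      where
      z : Fin (2 * n)
      z = vertex b j

      t′ : Fin k → Fin (2 * n)
      t′ = override t z

      class∈ : ∀ γ → cls (t′ γ) ∈ j ∷ P
      class∈ γ with γ ≟ c z
      ... | yes _ = here (cls-vertex b j)
      ... | no _  = there (meets-P γ)

      meets : ∀ {i} → i ∈ j ∷ P → Meets t′ i
      meets (here refl) = c z , trans (cong cls (override-at t z)) (cls-vertex b j)
      meets (there i∈) with γ , refl ← P-meets i∈ with γ ≟ c z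
      -- The class that the moved representative leaves is still met by its partner `η`.
      ... | yes refl = η , trans (cong cls (override-off t z η≢)) ηα
      ... | no  γ≢   = γ , cong cls (override-off t z γ≢)

    -- For two different single colours, the second vertices `a` and `b` of their classes are
    -- distinct and missed by `t`. The met classes then contain `k + 2` vertices, but at most `2s`,
    -- hence at most `k + 1`.
    single-unique : ∀ {α β} → ¬ Double α → ¬ Double β → α ≡ β
    single-unique {α} {β} ¬dα ¬dβ with α ≟ β
    ... | yes α≡β = α≡β
    ... | no  α≢β with a , a≢ , aα ← other (t α) | b , b≢ , bβ ← other (t β) = contradiction (begin
      2 + k             ≡⟨ cong (2 +_) length-t-all ⟨
      2 + length t-all  ≤⟨ length≤2* ((a≢b ∷ fresh ¬dα a≢ aα) ∷ fresh ¬dβ b≢ bβ ∷ t-all-unique) cls∈ ⟩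
      2 * length P      ≤⟨ ℕ.*-monoʳ-≤ 2 P≤s ⟩
      2 * s             ≤⟨ 2s≤1+k ⟩
      1 + k             ∎) ℕ.1+n≰n
      where
      open ℕ.≤-Reasoning
      a≢b : a ≢ b
      a≢b refl = ¬dα (β , α≢β ∘ sym , trans (sym bβ) aα)

      fresh : ∀ {x γ} → ¬ Double γ → x ≢ t γ → cls x ≡ cls (t γ) → All (x ≢_) t-all
      fresh {x} {γ} ¬d x≢ xγ = All.tabulate λ y∈ x≡y → lemma (∈-map⁻ t y∈) x≡y
        where
        lemma : ∀ {y} → (∃ λ η → η ∈ allFin k × y ≡ t η) → x ≢ y
        lemma (η , _ , refl) refl = ¬d (η , (λ { refl → x≢ refl }) , xγ)

      cls∈ : ∀ {x} → x ∈ a ∷ b ∷ t-all → cls x ∈ P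
      cls∈ (here refl)         = subst (_∈ P) (sym aα) (meets-P α)
      cls∈ (there (here refl)) = subst (_∈ P) (sym bβ) (meets-P β)
      cls∈ (there (there x∈))  = t-all∈P x∈

    s<O : s < length O
    s<O = ℕ.+-cancelˡ-< s s (length O) (begin-strict
      s + s                  ≡⟨ cong (s +_) (ℕ.+-identityʳ s) ⟨
      2 * s                  <⟨ 2s<n ⟩
      n                      ≡⟨ length-allFin n ⟨
      length (allFin n)      ≤⟨ unique-⊆⇒length≤ (Unique.allFin⁺ n) split ⟩
      length (P ++ O)        ≡⟨ length-++ P ⟩
      length P + length O    ≤⟨ ℕ.+-monoˡ-≤ (length O) P≤s ⟩
      s + length O           ∎)
      where
      open ℕ.≤-Reasoning
      split : allFin n ⊆ P ++ O
      split {j} j∈ with meets? j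
      ... | yes m = ∈-++⁺ˡ (∈-filter⁺ meets? j∈ m)
      ... | no ¬m = ∈-++⁺ʳ P (∈-filter⁺ (¬? ∘ meets?) j∈ ¬m)

    -- Every colour in an unmet class is single under `t`, and there is at most one single colour.
    -- More than `s` classes are unmet, so they contain a monochromatic edge.
    double⇒⊥ : ⊥
    double⇒⊥ = same-colour⇒⊥ (Unique.filter⁺ (¬? ∘ meets?) (Unique.allFin⁺ n)) s<O
      λ j∈ j′∈ b b′ → single-unique (outside-single (unmet j∈) b) (outside-single (unmet j′∈) b′)
      where
      unmet : ∀ {j} → j ∈ O → ¬ Meets t j
      unmet j∈ = proj₂ (∈-filter⁻ (¬? ∘ meets?) {xs = allFin n} j∈)

  -- Finding a section that uses a class twice

  preimage : Fin k → Fin (2 * n)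
  preimage γ = proj₁ (surjective γ)

  preimage-section : Section preimage
  preimage-section γ = proj₂ (surjective γ) refl

  n<k⇒⊥ : 3 ≤ s → 2 * s < n → n < k → ⊥
  n<k⇒⊥ 3≤s 2s<n n<k with γ , δ , γ<δ , eq ← pigeonhole n<k (cls ∘ preimage) =
    double⇒⊥ 3≤s (ℕ.<⇒≤ (ℕ.<-trans 2s<n (ℕ.m<n⇒m<1+n n<k))) 2s<n preimage-section (<⇒≢ γ<δ) eq

  k*s<n⇒⊥ : 3 ≤ s → 2 * s ≤ 1 + k → 2 * s < n → k * s < n → ⊥
  k*s<n⇒⊥ 3≤s 2s≤1+k 2s<n k*s<n with any? (λ i → ¬? (c (vertex zero i) ≟ c (vertex (suc zero) i)))
  ... | yes (i , cx≢cy) =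
    -- The section is redirected to both vertices of the bichromatic class `i`. The second
    -- redirection keeps the first because the colours differ.
    double⇒⊥ 3≤s 2s≤1+k 2s<n (override-section (override-section preimage-section x) y) cx≢cy
      (trans (cong cls (trans (override-off _ y cx≢cy) (override-at preimage x)))
        (trans (cls-vertex zero i) (trans (sym (cls-vertex (suc zero) i)) (cong cls (sym (override-at _ y))))))
    where
    x y : Fin (2 * n)
    x = vertex zero i
    y = vertex (suc zero) i
  -- All classes are monochromatic and no colour has more than `s` of them. A class is then
  -- determined by its colour and its position in the fibre, which embeds the classes into
  -- `Fin (k * s)`.
  ... | no none = ℕ.<⇒≱ k*s<n (injective⇒≤ place-injective)
    where
    d : Fin n → Fin k
    d i = c (vertex zero i)

    fibre : Fin k → List (Fin n)
    fibre γ = filter (λ i → d i ≟ γ) (allFin n)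

    colour≡d : ∀ b i → c (vertex b i) ≡ d i
    colour≡d zero       i = refl
    colour≡d (suc zero) i = sym (decidable-stable (_ ≟ _) λ ≢ → none (i , ≢))

    fibre≤s : ∀ γ → length (fibre γ) ≤ s
    fibre≤s γ = ℕ.≮⇒≥ λ s<fibre → same-colour⇒⊥ (Unique.filter⁺ (λ i → d i ≟ γ) (Unique.allFin⁺ n)) s<fibre
      λ j∈ j′∈ b b′ → trans (colour≡γ j∈ b) (sym (colour≡γ j′∈ b′))
      where
      colour≡γ : ∀ {j} → j ∈ fibre γ → ∀ b → c (vertex b j) ≡ γ
      colour≡γ {j} j∈ b = trans (colour≡d b j) (proj₂ (∈-filter⁻ (λ i → d i ≟ γ) {xs = allFin n} j∈))

    in-fibre : ∀ i → i ∈ fibre (d i)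
    in-fibre i = ∈-filter⁺ (λ j → d j ≟ d i) (∈-allFin i) refl

    slot : ∀ {i γ} → i ∈ fibre γ → Fin s
    slot {γ = γ} i∈ = inject≤ (Any.index i∈) (fibre≤s γ)

    -- The colours are variables here so that matching on their equality identifies the two fibres;
    -- `d i ≡ d j` could not be matched directly.
    slot-injective : ∀ {i j γ δ} (i∈ : i ∈ fibre γ) (j∈ : j ∈ fibre δ) → γ ≡ δ → slot i∈ ≡ slot j∈ → i ≡ j
    slot-injective i∈ j∈ refl eq = index-injective (setoid (Fin n)) i∈ j∈ (inject≤-injective _ _ _ _ eq)

    place : Fin n → Fin (k * s)
    place i = combine (d i) (slot (in-fibre i))

    place-injective : ∀ {i j} → place i ≡ place j → i ≡ j
    place-injective {i} {j} eq with d≡ , slot≡ ← combine-injective (d i) _ (d j) _ eq =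
      slot-injective (in-fibre i) (in-fibre j) d≡ slot≡

theorem3p3 : (r n : ℕ) (6≤r : 6 ≤ r) → 2 * (r ∸ 2) * (r ∸ 1) + 1 ≤ n →
    let instance _ = r∸2-nonZero 6≤r in
    (k : ℕ) → 1 ≤ k →
    (n < k → ¬ NMNRColourable (ℋ n r) k)
    × (⌈ n / r ∸ 2 ⌉ ≤ k → k ≤ n → NMNRColourable (ℋ n r) k)
    × (2 * r ∸ 5 ≤ k → k < ⌈ n / r ∸ 2 ⌉ → ¬ NMNRColourable (ℋ n r) k)
    × (2 ≤ k → k ≤ 2 * r ∸ 6 → NMNRColourable (ℋ n r) k)
theorem3p3 (suc (suc s)) n 6≤r@(s≤s (s≤s 4≤s)) n-large k 1≤k =
  (λ n<k C → NonColourable.n<k⇒⊥ C 3≤s 2s<n n<k) ,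
  (λ ⌈n/s⌉≤k k≤n → colourable-mod ⌈n/s⌉≤k 1≤k k≤n) ,
  (λ 2r∸5≤k k<⌈n/s⌉ C → NonColourable.k*s<n⇒⊥ C 3≤s (2s≤1+k 2r∸5≤k) 2s<n (<⌈/⌉⇒*< k<⌈n/s⌉)) ,
  (λ 2≤k k≤2r∸6 → colourable-few s≤n 2≤k (2+k≤2s k≤2r∸6))
  where
  instance
    s≢0 : NonZero s
    s≢0 = r∸2-nonZero 6≤r

  3≤s : 3 ≤ s
  3≤s = ℕ.<⇒≤ 4≤s

  2r≡4+2s : 2 * (2 + s) ≡ 4 + 2 * s
  2r≡4+2s = ℕ.*-distribˡ-+ 2 2 s

  2s<n : 2 * s < n
  2s<n = begin-strict
    2 * s                ≤⟨ ℕ.m≤m*n (2 * s) (suc s) ⟩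
    2 * s * suc s        <⟨ ℕ.m<m+n (2 * s * suc s) (s≤s z≤n) ⟩
    2 * s * suc s + 1    ≤⟨ n-large ⟩
    n                    ∎
    where open ℕ.≤-Reasoning

  s≤n : s ≤ n
  s≤n = ℕ.<⇒≤ (ℕ.≤-<-trans (ℕ.m≤n*m s 2) 2s<n)

  -- In terms of `s`, the bound `2r - 5` is `2s - 1`; adding 5 to both sides removes the truncated
  -- subtraction.
  2s≤1+k : 2 * (2 + s) ∸ 5 ≤ k → 2 * s ≤ 1 + k
  2s≤1+k 2r∸5≤k = ℕ.+-cancelˡ-≤ 4 _ _ (subst (_≤ 5 + k) 2r≡4+2s
    (ℕ.≤-trans (ℕ.m≤n+m∸n (2 * (2 + s)) 5) (ℕ.+-monoʳ-≤ 5 2r∸5≤k)))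

  -- Here `2r - 6` is `2s - 2`, and `2 ≤ 2 * s` ensures that the subtraction is not truncated.
  2+k≤2s : k ≤ 2 * (2 + s) ∸ 6 → 2 + k ≤ 2 * s
  2+k≤2s k≤2r∸6 = subst (_≤ 2 * s) (ℕ.+-comm k 2)
    (ℕ.m≤o∸n⇒m+n≤o k (ℕ.≤-trans (ℕ.<⇒≤ 3≤s) (ℕ.m≤n*m s 2)) (subst (λ m → k ≤ m ∸ 6) 2r≡4+2s k≤2r∸6))
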